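{- Let $\Gamma$ be a connected bipartite graph with ordered bipartition $(B|B')$, let $G\leq\mathrm{Aut}(\Gamma)$, let $1\neq N\lhd G$, and let $r$ be an integer with $r\geq 3$. Then the following are equivalent: (a) $\Gamma$ is $r$-starlike relative to $N$, and $\Gamma$ is locally $(G,4)$-distance transitive; (b) the adjacency design $\mathcal{D}(\Gamma)$ is $G$-pairwise transitive and $N$-nicely affine with $r$ parallel classes of blocks.
   Context: All graphs are finite, simple and without loops. Locally $(G,s)$-distance transitive ($s$ a positive integer): the graph has diameter at least $s$, admits $G$ as a subgroup of automorphisms, and for each vertex $v$ and each positive integer $i\leq s$ the stabiliser $G_v$ acts transitively on the set of vertices at distance $i$ from $v$. $r$-starlike: a connected bipartite graph $\Gamma$ with ordered bipartition $(B|B')$ is $r$-starlike relative to $N$ if $N\leq\mathrm{Aut}(\Gamma)$, $r$ is an integer with $r\geq 2$, $N$ is transitive on $B$, and $N$ has $r$ orbits on $B'$. A design $\mathcal{D}=(\mathcal{P},\mathcal{B},\mathcal{I})$ consists of a point set $\mathcal{P}$, a block set $\mathcal{B}$ and an incidence relation $\mathcal{I}\subseteq\mathcal{P}\times\mathcal{B}$. An automorphism of a design is a permutation of $\mathcal{P}\cup\mathcal{B}$ preserving points, blocks and incidence. Two distinct points are collinear if they are incident with at least one common block, and non-collinear otherwise; two distinct blocks are intersecting if they are incident with at least one common point, and non-intersecting otherwise. Adjacency design: for a bipartite graph $\Gamma$ with ordered bipartition $(B|B')$, the design $\mathcal{D}(\Gamma)$ has point set $B$ and block set $B'$, a point and a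 block being incident if and only if the corresponding vertices are adjacent in $\Gamma$. $G$-pairwise transitive: $G$ is a group of automorphisms of the design and is transitive on each of the following six (possibly empty) sets: incident point-block pairs, non-incident point-block pairs, collinear point pairs, non-collinear point pairs, intersecting block pairs, non-intersecting block pairs (pairs of points and pairs of blocks are ordered pairs of distinct elements). $N$-nicely affine: $N$ is a group of automorphisms of the design that is transitive on points, and there is a constant $\mu$ such that distinct blocks are incident with exactly $\mu$ common points if they are in different $N$-orbits and are disjoint (incident with no common point) if they are in the same $N$-orbit. Each $N$-orbit on blocks is then a parallel class, that is, the point subsets incident with the blocks in the orbit partition the point set; the $r$ parallel classes in (b) are these $N$-orbits.
   Formalization: The implication from (b) to (a) is stated only for Γ not complete bipartite; as written it fails for K_{2,3} with G = Sym(2)×Sym(3), N = Sym(2)×1, r = 3, where (b) holds but the diameter is 2. The implication from (a) to (b) is unchanged. -}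

module Defs where

open import Data.Fin.Base using (Fin)
open import Data.List.Base using (allFin; filter; length)
open import Data.Nat.Base using (ℕ; zero; suc; _≤_; NonZero)
open import Data.Product.Base using (_×_; _,_; ∃-syntax)
open import Data.Sum.Base using (_⊎_; inj₁; inj₂)
open import Function.Bundles using (_↔_; _⇔_; Inverse; Bijection)
open import Function.Construct.Composition using (_↔-∘_)
open import Function.Construct.Identity using (↔-id)
open import Function.Construct.Symmetry using (↔-sym)
open import Level using (0ℓ)
open import Relation.Binary.Bundles using (Setoid)
open import Relation.Binary.Core using (Rel; REL)
open import Relation.Binary.Definitions using (Symmetric; Irreflexive; Decidable)
open import Relation.Binary.PropositionalEquality
  using (_≡_; _≢_; _≗_; refl; sym; trans; cong; setoid)
open import Relation.Nullary.Decidable using (_×-dec_)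
open import Relation.Nullary.Negation using (¬_)
open import Relation.Unary using (Pred; _∈_; _⊆_)

------------------------------------------------------------------------
-- Permutation groups

Perm : Set → Set
Perm V = V ↔ V

infixr 9 _·_

_·_ : {V : Set} → Perm V → V → V
g · v = Inverse.to g v

-- Permutations are compared pointwise, so membership has to respect _≗_.
record PermGroup (V : Set) : Set₁ where
  field
    Elem     : Pred (Perm V) 0ℓ
    resp     : ∀ {g h} → (g ·_) ≗ (h ·_) → g ∈ Elem → h ∈ Elem
    has-id   : ↔-id V ∈ Elem
    closed-∘ : ∀ {g h} → g ∈ Elem → h ∈ Elem → (g ↔-∘ h) ∈ Elem
    closed-⁻¹ : ∀ {g} → g ∈ Elem → ↔-sym g ∈ Elem

open PermGroup public using (Elem)

infix 4 _⊴_

record _⊴_ {V : Set} (N G : PermGroup V) : Set where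
  field
    subgroup : Elem N ⊆ Elem G
    conj     : ∀ {g n} → g ∈ Elem G → n ∈ Elem N →
               (g ↔-∘ (n ↔-∘ ↔-sym g)) ∈ Elem N

Nontrivial : {V : Set} → PermGroup V → Set
Nontrivial N = ∃[ n ] (n ∈ Elem N × ∃[ v ] n · v ≢ v)

-- Below, ι : X → V is an injection, standing for the subset X of V.

Stabilises : {V X : Set} → PermGroup V → (X → V) → Set
Stabilises H ι = ∀ {h} → h ∈ Elem H → ∀ x → ∃[ y ] h · ι x ≡ ι y

SameOrbit : {V X : Set} → PermGroup V → (X → V) → Rel X 0ℓ
SameOrbit H ι x y = ∃[ h ] (h ∈ Elem H × h · ι x ≡ ι y)

TransitiveOn : {V X : Set} → PermGroup V → (X → V) → Set
TransitiveOn H ι = Stabilises H ι × (∀ x y → SameOrbit H ι x y)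

-- The quotient of this setoid is the set of H-orbits on X.
orbitSetoid : {V X : Set} → PermGroup V → (X → V) → Setoid 0ℓ 0ℓ
orbitSetoid {V} {X} H ι = record
  { Carrier = X
  ; _≈_ = SameOrbit H ι
  ; isEquivalence = record
    { refl  = ↔-id V , has-id , refl
    ; sym   = λ (h , h∈ , hx≡y) →
        ↔-sym h , closed-⁻¹ h∈ , Inverse.inverseʳ h (sym hx≡y)
    ; trans = λ (h , h∈ , hx≡y) (k , k∈ , ky≡z) →
        (k ↔-∘ h) , closed-∘ k∈ h∈ , trans (cong (k ·_) hx≡y) ky≡z
    }
  }
  where open PermGroup H

HasOrbits : {V X : Set} → PermGroup V → (X → V) → ℕ → Set
HasOrbits H ι r =
  Stabilises H ι × Bijection (orbitSetoid H ι) (setoid (Fin r))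

-- Transitivity on the set of pairs (x , y) with R x y, given as a subset of
-- V × V; holds vacuously when there are no such pairs.
TransitiveOnPairs : {V X Y : Set} → PermGroup V → (X → V) → (Y → V) →
                    REL X Y 0ℓ → Set
TransitiveOnPairs H ι κ R =
  ∀ {x y x′ y′} → R x y → R x′ y′ →
  ∃[ h ] (h ∈ Elem H × h · ι x ≡ ι x′ × h · κ y ≡ κ y′)

------------------------------------------------------------------------
-- Graphs

record Graph (V : Set) : Set₁ where
  field
    Adj    : Rel V 0ℓ
    adj?   : Decidable Adj
    symm   : Symmetric Adj
    irrefl : Irreflexive _≡_ Adj

open Graph public using (Adj; adj?)

module _ {V : Set} (Γ : Graph V) where

  data Walk : ℕ → V → V → Set where
    []  : ∀ {u} → Walk zero u u
    _∷_ : ∀ {k u v w} → Adj Γ u v → Walk k v w → Walk (suc k) u w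

  Connected : Set
  Connected = ∀ u v → ∃[ k ] Walk k u v

  Distance : V → V → ℕ → Set
  Distance u v d = Walk d u v × (∀ {k} → Walk k u v → d ≤ k)

  DiameterAtLeast : ℕ → Set
  DiameterAtLeast s = ∃[ u ] ∃[ v ] ∃[ d ] (Distance u v d × s ≤ d)

  IsGraphAut : Perm V → Set
  IsGraphAut g = ∀ u v → Adj Γ u v ⇔ Adj Γ (g · u) (g · v)

  ActsOnGraph : PermGroup V → Set
  ActsOnGraph G = ∀ {g} → g ∈ Elem G → IsGraphAut g

  record LocallyDistanceTransitive (G : PermGroup V) (s : ℕ)
                                   .{{_ : NonZero s}} : Set where
    field
      diameter   : DiameterAtLeast s
      acts       : ActsOnGraph G
      transitive : ∀ v i → 1 ≤ i → i ≤ s →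
                   ∀ {u w} → Distance v u i → Distance v w i →
                   ∃[ g ] (g ∈ Elem G × g · v ≡ v × g · u ≡ w)

------------------------------------------------------------------------
-- Bipartite graphs with ordered bipartition (B | B′), where B = Fin m is the
-- left summand and B′ = Fin n the right summand of the vertex set

Vertex : ℕ → ℕ → Set
Vertex m n = Fin m ⊎ Fin n

module _ {m n : ℕ} (Γ : Graph (Vertex m n)) where

  record Bipartite : Set where
    field
      left  : ∀ (x y : Fin m) → ¬ Adj Γ (inj₁ x) (inj₁ y)
      right : ∀ (x y : Fin n) → ¬ Adj Γ (inj₂ x) (inj₂ y)

  -- When Γ = K_{m,n} the adjacency design can be pairwise transitive and nicely
  -- affine (all parallel classes being singletons), although Γ has diameter at
  -- most 2; e.g. K_{2,3} with G = Sym 2 × Sym 3 and N = Sym 2 × 1.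
  CompleteBipartite : Set
  CompleteBipartite = ∀ (x : Fin m) (y : Fin n) → Adj Γ (inj₁ x) (inj₂ y)

  record Starlike (N : PermGroup (Vertex m n)) (r : ℕ) : Set where
    field
      connected    : Connected Γ
      bipartite    : Bipartite
      acts         : ActsOnGraph Γ N
      2≤r          : 2 ≤ r
      transitive-B : TransitiveOn N inj₁
      orbits-B′    : HasOrbits N inj₂ r

------------------------------------------------------------------------
-- Designs with m points and n blocks

record Design (m n : ℕ) : Set₁ where
  field
    _I_  : REL (Fin m) (Fin n) 0ℓ
    _I?_ : Decidable _I_

adjacencyDesign : ∀ {m n} → Graph (Vertex m n) → Design m n
adjacencyDesign Γ = record
  { _I_  = λ p b → Adj Γ (inj₁ p) (inj₂ b)
  ; _I?_ = λ p b → adj? Γ (inj₁ p) (inj₂ b)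
  }

module _ {m n : ℕ} (D : Design m n) where

  open Design D

  record IsDesignAut (g : Perm (Vertex m n)) : Set where
    field
      points    : ∀ p → ∃[ p′ ] g · inj₁ p ≡ inj₁ p′
      blocks    : ∀ b → ∃[ b′ ] g · inj₂ b ≡ inj₂ b′
      incidence : ∀ {p p′ b b′} → g · inj₁ p ≡ inj₁ p′ → g · inj₂ b ≡ inj₂ b′ →
                  p I b ⇔ p′ I b′

  ActsOnDesign : PermGroup (Vertex m n) → Set
  ActsOnDesign G = ∀ {g} → g ∈ Elem G → IsDesignAut g

  NonIncident : REL (Fin m) (Fin n) 0ℓ
  NonIncident p b = ¬ (p I b)

  Collinear NonCollinear : Rel (Fin m) 0ℓ
  Collinear    p q = p ≢ q × (∃[ b ] (p I b × q I b))
  NonCollinear p q = p ≢ q × ¬ (∃[ b ] (p I b × q I b))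

  Intersecting NonIntersecting : Rel (Fin n) 0ℓ
  Intersecting    b c = b ≢ c × (∃[ p ] (p I b × p I c))
  NonIntersecting b c = b ≢ c × ¬ (∃[ p ] (p I b × p I c))

  commonPoints : Fin n → Fin n → ℕ
  commonPoints b c = length (filter (λ p → (p I? b) ×-dec (p I? c)) (allFin m))

  record PairwiseTransitive (G : PermGroup (Vertex m n)) : Set where
    field
      acts            : ActsOnDesign G
      incident        : TransitiveOnPairs G inj₁ inj₂ _I_
      nonIncident     : TransitiveOnPairs G inj₁ inj₂ NonIncident
      collinear       : TransitiveOnPairs G inj₁ inj₁ Collinear
      nonCollinear    : TransitiveOnPairs G inj₁ inj₁ NonCollinear
      intersecting    : TransitiveOnPairs G inj₂ inj₂ Intersecting
      nonIntersecting : TransitiveOnPairs G inj₂ inj₂ NonIntersecting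

  record NicelyAffine (N : PermGroup (Vertex m n)) : Set where
    field
      acts       : ActsOnDesign N
      transitive : TransitiveOn N inj₁
      μ          : ℕ
      meet       : ∀ {b c} → b ≢ c → ¬ SameOrbit N inj₂ b c → commonPoints b c ≡ μ
      disjoint   : ∀ {b c} → b ≢ c → SameOrbit N inj₂ b c →
                   ¬ (∃[ p ] (p I b × p I c))

  -- The parallel classes of an N-nicely affine design are the N-orbits on blocks.
  NicelyAffineWithClasses : PermGroup (Vertex m n) → ℕ → Set
  NicelyAffineWithClasses N r = NicelyAffine N × HasOrbits N inj₂ r

{-# OPTIONS --safe #-}

-- Both directions rest on the same picture: as N is transitive on points, every
-- point lies on a block of each N-class, and two distinct blocks meet exactly
-- when their classes differ.  Hence collinear and non-collinear points are at
-- distance 2 and 4, likewise for blocks, and non-incident point-block pairs are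
-- at distance 3, so the two transitivity conditions translate into each other.
--
-- Given (a), the stabiliser of a block b is transitive on the blocks at distance
-- 2 from b, some of which lie outside the class of b; hence all do.  Similarly
-- all blocks at distance 4 from b lie in the class of b.  So blocks of different
-- classes joined by a walk of length 4 meet, and with a third class at hand this
-- propagates along arbitrary walks.  Given (b), the constant μ is positive
-- because a point lies on blocks of two different classes.

module Submission where

open import Defs
open import Data.Fin.Base using (Fin; zero; suc)
open import Data.Fin.Properties using (_≟_; any?; all?; ¬∀⟶∃¬)
open import Data.List.Base using (List; []; _∷_; allFin; filter; length; map)
open import Data.List.Membership.Propositional using () renaming (_∈_ to _∈ₗ_)
open import Data.List.Membership.Propositional.Properties
  using (∈-length; ∈-allFin; ∈-filter⁺; ∈-filter⁻; ∈-map∘filter⁺; ∈-map∘filter⁻)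
open import Data.List.Membership.Propositional.Properties.WithK using (unique∧set⇒bag)
open import Data.List.Properties using (length-map)
open import Data.List.Relation.Binary.BagAndSetEquality using (∼bag⇒↭)
open import Data.List.Relation.Binary.Permutation.Propositional.Properties using (↭-length)
open import Data.List.Relation.Unary.Any using (here)
open import Data.List.Relation.Unary.Unique.Propositional.Properties
  using (map⁺; filter⁺; allFin⁺)
open import Data.Nat.Base using (ℕ; zero; suc; parity; _≤_; _<_; z≤n; s≤s)
open import Data.Nat.Properties using (≤-trans; n≤1+n)
open import Data.Parity.Base as ℙ using (Parity; 0ℙ; 1ℙ; _⁻¹)
open import Data.Parity.Properties using (+-cancelʳ-≡)
open import Data.Product.Base using (_×_; _,_; proj₁; proj₂; ∃-syntax)
open import Data.Sum.Base using (inj₁; inj₂)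
open import Data.Sum.Properties using (inj₁-injective; inj₂-injective)
open import Function.Base using (_∘_)
open import Function.Bundles using (Inverse; Equivalence; mk⇔; Bijection)
open import Function.Construct.Composition using (_↔-∘_)
open import Function.Construct.Symmetry using (↔-sym)
open import Function.Definitions using (Injective)
open import Level using (0ℓ)
open import Relation.Binary.PropositionalEquality
  using (_≡_; _≢_; refl; sym; trans; cong; subst; subst₂)
open import Relation.Nullary.Decidable using (Dec; yes; no; _×-dec_; decidable-stable)
open import Relation.Nullary.Negation using (¬_; contradiction)
open import Relation.Unary using (Pred; Decidable; _∈_)

-- Finite index sets and counting by filtered lists.

third : ∀ {r} → 3 ≤ r → (i j : Fin r) → ∃[ k ] (k ≢ i × k ≢ j)
third (s≤s (s≤s (s≤s _))) zero          zero          = suc zero , (λ ()) , (λ ())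
third (s≤s (s≤s (s≤s _))) zero          (suc zero)    = suc (suc zero) , (λ ()) , (λ ())
third (s≤s (s≤s (s≤s _))) zero          (suc (suc _)) = suc zero , (λ ()) , (λ ())
third (s≤s (s≤s (s≤s _))) (suc zero)    zero          = suc (suc zero) , (λ ()) , (λ ())
third (s≤s (s≤s (s≤s _))) (suc (suc _)) zero          = suc zero , (λ ()) , (λ ())
third (s≤s (s≤s (s≤s _))) (suc _)       (suc _)       = zero , (λ ()) , (λ ())

length⁺⇒∃∈ : ∀ {A : Set} (xs : List A) → 0 < length xs → ∃[ x ] x ∈ₗ xs
length⁺⇒∃∈ (x ∷ _) _ = x , here refl

-- Both filtered lists are free of duplicates, and the image of the first under `f` has the same
-- elements as the second, so the two are permutations of each other.
length-filter-allFin : ∀ {m} {P Q : Pred (Fin m) 0ℓ} (P? : Decidable P) (Q? : Decidable Q)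
  (f : Fin m → Fin m) → Injective _≡_ _≡_ f → (∀ {i} → P i → Q (f i)) →
  (∀ {j} → Q j → ∃[ i ] (P i × j ≡ f i)) →
  length (filter P? (allFin m)) ≡ length (filter Q? (allFin m))
length-filter-allFin {m} P? Q? f f-inj P⇒Q Q⇒P =
  trans (sym (length-map f (filter P? (allFin m))))
    (↭-length (∼bag⇒↭ (unique∧set⇒bag
      (map⁺ f-inj (filter⁺ P? (allFin⁺ m))) (filter⁺ Q? (allFin⁺ m)) (mk⇔ to from))))
  where
  to : ∀ {j} → j ∈ₗ map f (filter P? (allFin m)) → j ∈ₗ filter Q? (allFin m)
  to j∈ with _ , _ , refl , Pi ← ∈-map∘filter⁻ f P? {xs = allFin m} j∈ = ∈-filter⁺ Q? (∈-allFin _) (P⇒Q Pi)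

  from : ∀ {j} → j ∈ₗ filter Q? (allFin m) → j ∈ₗ map f (filter P? (allFin m))
  from j∈ with i , Pi , j≡fi ← Q⇒P (proj₂ (∈-filter⁻ Q? {xs = allFin m} j∈)) =
    ∈-map∘filter⁺ f P? (i , ∈-allFin i , j≡fi , Pi)

·-injective : ∀ {V : Set} (g : Perm V) {u v} → g · u ≡ g · v → u ≡ v
·-injective g gu≡gv =
  trans (sym (Inverse.strictlyInverseʳ g _)) (Inverse.inverseʳ g gu≡gv)

-- Walks and distances in a bipartite graph.

side : ∀ {m n} → Vertex m n → Parity
side (inj₁ _) = 0ℙ
side (inj₂ _) = 1ℙ

module Walks {m n} (Γ : Graph (Vertex m n)) (bip : Bipartite Γ) where

  open Graph Γ using (symm; irrefl)
  open Bipartite bip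

  side-adj : ∀ {u v} → Adj Γ u v → side v ≡ side u ⁻¹
  side-adj {inj₁ x} {inj₁ y} a = contradiction a (left x y)
  side-adj {inj₁ _} {inj₂ _} _ = refl
  side-adj {inj₂ _} {inj₁ _} _ = refl
  side-adj {inj₂ x} {inj₂ y} a = contradiction a (right x y)

  side-walk : ∀ {k u v} → Walk Γ k u v → side v ≡ parity k ℙ.+ side u
  side-walk [] = refl
  side-walk {suc k} {u} (a ∷ w) =
    trans (side-walk w) (trans (cong (parity k ℙ.+_) (side-adj a)) (shift k (side u)))
    where
    -- The recursion goes down by two because `parity` does.
    shift : ∀ k s → parity k ℙ.+ s ⁻¹ ≡ parity (suc k) ℙ.+ s
    shift zero          _  = refl
    shift (suc zero)    0ℙ = refl
    shift (suc zero)    1ℙ = refl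
    shift (suc (suc k)) s  = shift k s

  -- The side of the common start cancels. In the distance lemmas below this excludes shorter walks
  -- of the wrong parity.
  parity-walk : ∀ {j k u v} → Walk Γ j u v → Walk Γ k u v → parity j ≡ parity k
  parity-walk {u = u} w w′ =
    +-cancelʳ-≡ (side u) _ _ (trans (sym (side-walk w)) (side-walk w′))

  distance-1 : ∀ {u v} → Adj Γ u v → Distance Γ u v 1
  distance-1 {u} {v} a = a ∷ [] , shortest
    where
    shortest : ∀ {k} → Walk Γ k u v → 1 ≤ k
    shortest []      = contradiction a (irrefl refl)
    shortest (_ ∷ _) = s≤s z≤n

  distance-2 : ∀ {u v} → u ≢ v → Walk Γ 2 u v → Distance Γ u v 2
  distance-2 {u} {v} u≢v w = w , shortest
    where
    shortest : ∀ {k} → Walk Γ k u v → 2 ≤ k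
    shortest {0} [] = contradiction refl u≢v
    shortest {1} w′ = contradiction (parity-walk w w′) λ ()
    shortest {suc (suc _)} _ = s≤s (s≤s z≤n)

  distance-3 : ∀ {u v} → ¬ Adj Γ u v → Walk Γ 3 u v → Distance Γ u v 3
  distance-3 {u} {v} ¬a w = w , shortest
    where
    shortest : ∀ {k} → Walk Γ k u v → 3 ≤ k
    shortest {0} w′       = contradiction (parity-walk w w′) λ ()
    shortest {1} (a ∷ []) = contradiction a ¬a
    shortest {2} w′       = contradiction (parity-walk w w′) λ ()
    shortest {suc (suc (suc _))} _ = s≤s (s≤s (s≤s z≤n))

  distance-4 : ∀ {u v} → u ≢ v → ¬ Walk Γ 2 u v → Walk Γ 4 u v → Distance Γ u v 4
  distance-4 {u} {v} u≢v ¬w₂ w = w , shortest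
    where
    shortest : ∀ {k} → Walk Γ k u v → 4 ≤ k
    shortest {0} [] = contradiction refl u≢v
    shortest {1} w′ = contradiction (parity-walk w w′) λ ()
    shortest {2} w′ = contradiction w′ ¬w₂
    shortest {3} w′ = contradiction (parity-walk w w′) λ ()
    shortest {suc (suc (suc (suc _)))} _ = s≤s (s≤s (s≤s (s≤s z≤n)))

  distance⇒≢ : ∀ {u v d} → Distance Γ u v (suc d) → u ≢ v
  distance⇒≢ (_ , shortest) refl with () ← shortest []

  -- The adjacency design read off from walks.

  D : Design m n
  D = adjacencyDesign Γ

  open Design D public

  Join : Fin m → Fin m → Set
  Join p q = ∃[ b ] (p I b × q I b)

  Meet : Fin n → Fin n → Set
  Meet b c = ∃[ p ] (p I b × p I c)

  meet? : ∀ b c → Dec (Meet b c)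
  meet? b c = any? λ p → (p I? b) ×-dec (p I? c)

  join⇒walk : ∀ {p q} → Join p q → Walk Γ 2 (inj₁ p) (inj₁ q)
  join⇒walk (_ , pb , qb) = pb ∷ symm qb ∷ []

  walk⇒join : ∀ {p q} → Walk Γ 2 (inj₁ p) (inj₁ q) → Join p q
  walk⇒join (_∷_ {v = inj₁ _} a _)        = contradiction a (left _ _)
  walk⇒join (_∷_ {v = inj₂ b} a (a′ ∷ [])) = b , a , symm a′

  meet⇒walk : ∀ {b c} → Meet b c → Walk Γ 2 (inj₂ b) (inj₂ c)
  meet⇒walk (_ , pb , pc) = symm pb ∷ pc ∷ []

  walk⇒meet : ∀ {b c} → Walk Γ 2 (inj₂ b) (inj₂ c) → Meet b c
  walk⇒meet (_∷_ {v = inj₁ p} a (a′ ∷ [])) = p , symm a , a′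
  walk⇒meet (_∷_ {v = inj₂ _} a _)        = contradiction a (right _ _)

  meet-meet⇒walk : ∀ {b x c} → Meet b x → Meet x c → Walk Γ 4 (inj₂ b) (inj₂ c)
  meet-meet⇒walk (_ , pb , px) (_ , qx , qc) = symm pb ∷ px ∷ symm qx ∷ qc ∷ []

  walk⇒meet-meet : ∀ {b c} → Walk Γ 4 (inj₂ b) (inj₂ c) → ∃[ x ] (Meet b x × Meet x c)
  walk⇒meet-meet (_∷_ {v = inj₂ _} a _) = contradiction a (right _ _)
  walk⇒meet-meet (_∷_ {v = inj₁ _} _ (_∷_ {v = inj₁ _} a _)) = contradiction a (left _ _)
  walk⇒meet-meet (_∷_ {v = inj₁ _} a (_∷_ {v = inj₂ x} a′ w)) =
    x , (_ , symm a , a′) , walk⇒meet w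

  -- The walk from `b` to a different vertex is nonempty, and its first edge leads to a point.
  pointOn : Connected Γ → ∀ {v} b → v ≢ inj₂ b → ∃[ p ] p I b
  pointOn conn {v} b v≢b with conn (inj₂ b) v
  ... | _ , []                   = contradiction refl v≢b
  ... | _ , _∷_ {v = inj₁ q} a _ = q , symm a
  ... | _ , _∷_ {v = inj₂ _} a _ = contradiction a (right _ _)

  private
    side-distance : ∀ {u v d} → Distance Γ u v d → side v ≡ parity d ℙ.+ side u
    side-distance (w , _) = side-walk w

    distance-1⇒adj : ∀ {u v} → Distance Γ u v 1 → Adj Γ u v
    distance-1⇒adj (a ∷ [] , _) = a

    distance-3⇒¬adj : ∀ {u v} → Distance Γ u v 3 → ¬ Adj Γ u v
    distance-3⇒¬adj (_ , shortest) a with s≤s () ← shortest (a ∷ [])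

    distance-4⇒¬walk-2 : ∀ {u v} → Distance Γ u v 4 → ¬ Walk Γ 2 u v
    distance-4⇒¬walk-2 (_ , shortest) w with s≤s (s≤s ()) ← shortest w

  -- Here and in the seven lemmas that follow, the parity of the distance decides which part
  -- contains `u`, and minimality of the distance supplies whatever inequality or negation the
  -- design relation asks for.
  point-distance-1 : ∀ {p u} → Distance Γ (inj₁ p) u 1 → ∃[ b ] (u ≡ inj₂ b × p I b)
  point-distance-1 {u = inj₁ _} δ with () ← side-distance δ
  point-distance-1 {u = inj₂ b} δ = b , refl , distance-1⇒adj δ

  point-distance-2 : ∀ {p u} → Distance Γ (inj₁ p) u 2 → ∃[ q ] (u ≡ inj₁ q × Collinear D p q)
  point-distance-2 {u = inj₁ q} δ = q , refl , distance⇒≢ δ ∘ cong inj₁ , walk⇒join (proj₁ δ)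
  point-distance-2 {u = inj₂ _} δ with () ← side-distance δ

  point-distance-3 : ∀ {p u} → Distance Γ (inj₁ p) u 3 → ∃[ b ] (u ≡ inj₂ b × NonIncident D p b)
  point-distance-3 {u = inj₁ _} δ with () ← side-distance δ
  point-distance-3 {u = inj₂ b} δ = b , refl , distance-3⇒¬adj δ

  point-distance-4 : ∀ {p u} → Distance Γ (inj₁ p) u 4 → ∃[ q ] (u ≡ inj₁ q × NonCollinear D p q)
  point-distance-4 {u = inj₁ q} δ =
    q , refl , distance⇒≢ δ ∘ cong inj₁ , distance-4⇒¬walk-2 δ ∘ join⇒walk
  point-distance-4 {u = inj₂ _} δ with () ← side-distance δ

  block-distance-1 : ∀ {b u} → Distance Γ (inj₂ b) u 1 → ∃[ p ] (u ≡ inj₁ p × p I b)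
  block-distance-1 {u = inj₁ p} δ = p , refl , symm (distance-1⇒adj δ)
  block-distance-1 {u = inj₂ _} δ with () ← side-distance δ

  block-distance-2 : ∀ {b u} → Distance Γ (inj₂ b) u 2 → ∃[ c ] (u ≡ inj₂ c × Intersecting D b c)
  block-distance-2 {u = inj₁ _} δ with () ← side-distance δ
  block-distance-2 {u = inj₂ c} δ = c , refl , distance⇒≢ δ ∘ cong inj₂ , walk⇒meet (proj₁ δ)

  block-distance-3 : ∀ {b u} → Distance Γ (inj₂ b) u 3 → ∃[ p ] (u ≡ inj₁ p × NonIncident D p b)
  block-distance-3 {u = inj₁ p} δ = p , refl , distance-3⇒¬adj δ ∘ symm
  block-distance-3 {u = inj₂ _} δ with () ← side-distance δ

  block-distance-4 : ∀ {b u} → Distance Γ (inj₂ b) u 4 → ∃[ c ] (u ≡ inj₂ c × NonIntersecting D b c)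
  block-distance-4 {u = inj₁ _} δ with () ← side-distance δ
  block-distance-4 {u = inj₂ c} δ =
    c , refl , distance⇒≢ δ ∘ cong inj₂ , distance-4⇒¬walk-2 δ ∘ meet⇒walk

-- Graph automorphisms acting on walks, incidences and the two parts.

module Action {m n} (Γ : Graph (Vertex m n)) (bip : Bipartite Γ)
              (G : PermGroup (Vertex m n)) (acts : ActsOnGraph Γ G) where

  open Walks Γ bip
  open PermGroup G using (closed-∘; closed-⁻¹)

  adj-· : ∀ {g u v} → g ∈ Elem G → Adj Γ u v → Adj Γ (g · u) (g · v)
  adj-· g∈ = Equivalence.to (acts g∈ _ _)

  walk-· : ∀ {g k u v} → g ∈ Elem G → Walk Γ k u v → Walk Γ k (g · u) (g · v)
  walk-· g∈ []      = []
  walk-· g∈ (a ∷ w) = adj-· g∈ a ∷ walk-· g∈ w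

  distance-· : ∀ {g u v d} → g ∈ Elem G → Distance Γ u v d → Distance Γ (g · u) (g · v) d
  distance-· {g} g∈ (w , shortest) = walk-· g∈ w , λ w′ →
    shortest (subst₂ (Walk Γ _) (Inverse.strictlyInverseʳ g _) (Inverse.strictlyInverseʳ g _)
      (walk-· (closed-⁻¹ g∈) w′))

  incident-· : ∀ {g p p′ b b′} → g ∈ Elem G →
    g · inj₁ p ≡ inj₁ p′ → g · inj₂ b ≡ inj₂ b′ → p I b → p′ I b′
  incident-· g∈ gp gb pb = subst₂ (Adj Γ) gp gb (adj-· g∈ pb)

  actsOnDesign : Stabilises G inj₁ → Stabilises G inj₂ → ActsOnDesign D G
  actsOnDesign stab₁ stab₂ {g} g∈ = record
    { points = stab₁ g∈
    ; blocks = stab₂ g∈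
    ; incidence = λ gp gb → mk⇔ (incident-· g∈ gp gb)
        (incident-· (closed-⁻¹ g∈) (Inverse.inverseʳ g (sym gp)) (Inverse.inverseʳ g (sym gb)))
    }

  -- As `g` keeps points among points, it induces an injection `f` of `Fin m`; the inverse of `g`
  -- supplies preimages, so common points correspond one to one.
  commonPoints-· : Stabilises G inj₁ → ∀ {g b b′ c c′} → g ∈ Elem G →
    g · inj₂ b ≡ inj₂ b′ → g · inj₂ c ≡ inj₂ c′ → commonPoints D b c ≡ commonPoints D b′ c′
  commonPoints-· stab₁ {g} {b} {b′} {c} {c′} g∈ gb gc = length-filter-allFin
    (λ p → (p I? b) ×-dec (p I? c)) (λ p → (p I? b′) ×-dec (p I? c′)) f f-inj
    (λ (pb , pc) → incident-· g∈ (f-eq _) gb pb , incident-· g∈ (f-eq _) gc pc)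
    (λ {q} (qb , qc) →
      let p , gq = stab₁ (closed-⁻¹ g∈) q in
      p ,
      ( incident-· (closed-⁻¹ g∈) gq (Inverse.inverseʳ g (sym gb)) qb
      , incident-· (closed-⁻¹ g∈) gq (Inverse.inverseʳ g (sym gc)) qc) ,
      inj₁-injective (trans (sym (Inverse.inverseˡ g (sym gq))) (f-eq p)))
    where
    f : Fin m → Fin m
    f p = proj₁ (stab₁ g∈ p)

    f-eq : ∀ p → g · inj₁ p ≡ inj₁ (f p)
    f-eq p = proj₂ (stab₁ g∈ p)

    f-inj : Injective _≡_ _≡_ f
    f-inj {p} {q} fp≡fq = inj₁-injective
      (·-injective g (trans (f-eq p) (trans (cong inj₁ fp≡fq) (sym (f-eq q)))))

  -- A walk between vertices of one part has even length, and so does its image.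
  side-· : Connected Γ → ∀ {g u v} → g ∈ Elem G → side u ≡ side v → side (g · u) ≡ side (g · v)
  side-· conn {g} {u} {v} g∈ eq =
    let k , w = conn u v
        even = +-cancelʳ-≡ (side u) (parity k) 0ℙ (trans (sym (side-walk w)) (sym eq))
    in sym (trans (side-walk (walk-· g∈ w)) (cong (ℙ._+ side (g · u)) even))

-- Classes of blocks under a point-transitive group.

module Classes {m n} (Γ : Graph (Vertex m n)) (conn : Connected Γ) (bip : Bipartite Γ)
               (N : PermGroup (Vertex m n)) (acts : ActsOnGraph Γ N)
               (transB : TransitiveOn N inj₁) {r} (orbits : HasOrbits N inj₂ r) where

  open Walks Γ bip
  private module O = Bijection (proj₂ orbits)

  -- Labelling the orbits by `Fin r` turns lying in one orbit into a decidable equality.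
  class : Fin n → Fin r
  class = O.to

  sameClass : ∀ {b c} → SameOrbit N inj₂ b c → class b ≡ class c
  sameClass = O.cong

  sameOrbit : ∀ {b c} → class b ≡ class c → SameOrbit N inj₂ b c
  sameOrbit = O.injective

  representative : ∀ i → ∃[ b ] class b ≡ i
  representative i = let b , eq = O.surjective i in b , eq (O.Eq₁.refl {b})

  -- Some block of class `i` has a point `q`; an element of `N` taking `q` to `p` moves that block
  -- within its class to one through `p`.
  blockThrough : ∀ p i → ∃[ b ] (p I b × class b ≡ i)
  blockThrough p i =
    let c , cls = representative i
        q , qc = pointOn conn {inj₁ p} c (λ ())
        h , h∈ , hq = proj₂ transB q p
        b , hc = proj₁ orbits h∈ c
    in b , Action.incident-· Γ bip N acts h∈ hq hc qc
         , trans (sym (sameClass (h , h∈ , hc))) cls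

  module _ (3≤r : 3 ≤ r) where

    firstBlock : Fin n
    firstBlock = proj₁ (representative (first 3≤r))
      where
      first : 3 ≤ r → Fin r
      first (s≤s _) = zero

    otherClass : ∀ b → ∃[ i ] i ≢ class b
    otherClass b = let i , i≢b , _ = third 3≤r (class b) (class b) in i , i≢b

    -- The two directions obtain `meets` by different arguments and share these consequences, which
    -- bound the distances from above.
    module AllMeet (meets : ∀ {b c} → class b ≢ class c → Meet b c) where

      block-walk : ∀ b c → Walk Γ 4 (inj₂ b) (inj₂ c)
      block-walk b c =
        -- A block of a class other than those of `b` and `c` meets both, even if these two classes
        -- coincide.
        let i , i≢b , i≢c = third 3≤r (class b) (class c)
            x , x-i = representative i
        in meet-meet⇒walk (meets λ b~x → i≢b (trans (sym x-i) (sym b~x)))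
                          (meets λ x~c → i≢c (trans (sym x-i) x~c))

      point-block-walk : ∀ p b → Walk Γ 3 (inj₁ p) (inj₂ b)
      point-block-walk p b =
        let i , i≢b = otherClass b
            c , pc , c-i = blockThrough p i
        in pc ∷ meet⇒walk (meets λ c~b → i≢b (trans (sym c-i) c~b))

      point-walk : ∀ p q → Walk Γ 4 (inj₁ p) (inj₁ q)
      point-walk p q =
        -- The class of `b` is an arbitrary choice; what matters is that `c` through `q` is taken
        -- from another class, so that `b` and `c` share a point `x`.
        let b , pb , _ = blockThrough p (class firstBlock)
            i , i≢b = otherClass b
            c , qc , c-i = blockThrough q i
            x , xb , xc = meets λ b~c → i≢b (trans (sym c-i) (sym b~c))
        in pb ∷ symm xb ∷ xc ∷ symm qc ∷ []
        where
        open Graph Γ using (symm)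

-- From local distance transitivity to a pairwise transitive, nicely affine design.

module Forward {m n} (Γ : Graph (Vertex m n)) (G N : PermGroup (Vertex m n)) {r : ℕ}
               (conn : Connected Γ) (bip : Bipartite Γ) (acts : ActsOnGraph Γ G)
               (N⊴G : N ⊴ G) (3≤r : 3 ≤ r)
               (transB : TransitiveOn N inj₁) (orbits : HasOrbits N inj₂ r)
               (ldt : LocallyDistanceTransitive Γ G 4) where

  open Graph Γ using (symm)
  open PermGroup G using (closed-∘; closed-⁻¹)
  open _⊴_ N⊴G
  open Walks Γ bip
  open Action Γ bip G acts
  open Classes Γ conn bip N (λ h∈ → acts (subgroup h∈)) transB orbits
  open LocallyDistanceTransitive ldt using (transitive)

  -- An element of G swapping the two parts would conjugate N, which is
  -- transitive on points, to a group transitive on blocks.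
  stab₁ : Stabilises G inj₁
  stab₁ {g} g∈ p with g · inj₁ p in gp
  ... | inj₁ q = q , refl
  ... | inj₂ b =
    let i , i≢ = otherClass 3≤r (firstBlock 3≤r)
        c , c-i = representative i
    in contradiction (trans (sym c-i) (sameClass (transitive-blocks c (firstBlock 3≤r)))) i≢
    where
    pull : ∀ c → ∃[ q ] ↔-sym g · inj₂ c ≡ inj₁ q
    pull c with ↔-sym g · inj₂ c in eq
    ... | inj₁ q = q , refl
    -- The inverse of `g` takes the block `b` to the point `p`, and by `side-·` it takes all blocks
    -- to the same side.
    ... | inj₂ _ with () ← trans (sym (cong side eq)) (trans
      (side-· conn {u = inj₂ c} {v = inj₂ b} (closed-⁻¹ g∈) refl)
      (cong side (Inverse.inverseʳ g (sym gp))))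

    transitive-blocks : ∀ c d → SameOrbit N inj₂ c d
    transitive-blocks c d =
      let q , gq = pull c
          s , gs = pull d
          h , h∈ , hq = proj₂ transB q s
      in g ↔-∘ (h ↔-∘ ↔-sym g) , conj g∈ h∈ ,
         trans (cong (λ v → g · h · v) gq)
           (trans (cong (g ·_) hq) (Inverse.inverseˡ g (sym gs)))

  -- Otherwise the inverse of `g` would send a point to a block, against `stab₁`.
  stab₂ : Stabilises G inj₂
  stab₂ {g} g∈ b with g · inj₂ b in gb
  ... | inj₂ c = c , refl
  ... | inj₁ p with _ , eq ← stab₁ (closed-⁻¹ g∈) p
      with () ← trans (sym eq) (Inverse.inverseʳ g (sym gb))

  -- Normality: the conjugate by `g` of an element of `N` taking `b` to `c` lies in `N` and takes
  -- `b′` to `c′`. Thus `G` permutes the classes.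
  class-· : ∀ {g b b′ c c′} → g ∈ Elem G → g · inj₂ b ≡ inj₂ b′ → g · inj₂ c ≡ inj₂ c′ →
            class b ≡ class c → class b′ ≡ class c′
  class-· {g} g∈ gb gc b~c =
    let h , h∈ , hb = sameOrbit b~c
    in sameClass (g ↔-∘ (h ↔-∘ ↔-sym g) , conj g∈ h∈ ,
         trans (cong (λ v → g · h · v) (Inverse.inverseʳ g (sym gb)))
           (trans (cong (g ·_) hb) gc))

  -- If they met at `p`, a block `x` of another class through `p` would also be at distance 2 from
  -- `b`. An element fixing `b` and taking `c` to `x` would have to respect classes, which is
  -- absurd.
  disjoint : ∀ {b c} → class b ≡ class c → b ≢ c → ¬ Meet b c
  disjoint {b} {c} b~c b≢c (p , pb , pc) =
    let i , i≢b = otherClass 3≤r b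
        x , px , x-i = blockThrough p i
        g , g∈ , gb , gc = transitive (inj₂ b) 2 (s≤s z≤n) (s≤s (s≤s z≤n))
          (distance-2 (b≢c ∘ inj₂-injective) (meet⇒walk (p , pb , pc)))
          (distance-2 (λ eq → i≢b (trans (sym x-i) (cong class (sym (inj₂-injective eq)))))
            (meet⇒walk (p , pb , px)))
    in i≢b (trans (sym x-i) (sym (class-· g∈ gb gc b~c)))

  meet-trans : ∀ {b x c} → class b ≢ class c → Meet b x → Meet x c → Meet b c
  meet-trans {b} {x} {c} b≁c bx (q , qx , qc) = decidable-stable (meet? b c) λ ¬bc →
    -- If `b` and `c` fail to meet, they are at distance 4. The block `c′` in the class of `b`
    -- through `q` is at distance 4 from `b` as well: it differs from `b` because it meets `c`, and
    -- is then disjoint from `b`. Taking `c′` to `c` while fixing `b` would put `c` in the class of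
    -- `b`.
    let c′ , qc′ , c′~b = blockThrough q (class b)
        b≢c′ = λ b≡c′ → ¬bc (q , subst (q I_) (sym b≡c′) qc′ , qc)
        g , g∈ , gb , gc′ = transitive (inj₂ b) 4 (s≤s z≤n) (s≤s (s≤s (s≤s (s≤s z≤n))))
          (distance-4 (b≢c′ ∘ inj₂-injective)
            (disjoint (sym c′~b) b≢c′ ∘ walk⇒meet) (meet-meet⇒walk bx (q , qx , qc′)))
          (distance-4 (b≁c ∘ cong class ∘ inj₂-injective)
            (¬bc ∘ walk⇒meet) (meet-meet⇒walk bx (q , qx , qc)))
    in b≁c (class-· g∈ gb gc′ (sym c′~b))

  -- The invariant carried along walks from `b`. Its second half is the goal; the first half keeps a
  -- link to `b` while the walk passes through the class of `b`, where the second half says nothing.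
  Near : Fin n → Fin n → Set
  Near b c = (∃[ x ] (Meet b x × Meet x c)) × (class b ≢ class c → Meet b c)

  near-refl : ∀ b → Near b b
  near-refl b =
    -- A block of another class is a vertex different from `b`, as `pointOn` requires; `b` then
    -- serves as its own intermediate block.
    let i , i≢b = otherClass 3≤r b
        c , c-i = representative i
        p , pb = pointOn conn {inj₂ c} b
          (λ c≡b → i≢b (trans (sym c-i) (cong class (inj₂-injective c≡b))))
        bb = p , pb , pb
    in (b , bb , bb) , λ _ → bb

  near-meet : ∀ {b c d} → Near b c → Meet c d → Near b d
  near-meet {b} {c} {d} near cd with class b ≟ class c | class b ≟ class d | c ≟ d
  ... | _       | _       | yes refl = near
  ... | no b≁c  | _       | _ =
    -- Here `c` itself meets `b` and becomes the new intermediate block.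
    let bc = proj₂ near b≁c in (c , bc , cd) , λ b≁d → meet-trans b≁d bc cd
  ... | yes b~c | yes b~d | no c≢d = contradiction cd (disjoint (trans (sym b~c) b~d) c≢d)
  ... | yes _   | no b≁d  | _ =
    -- A block y of a third class through a point common to x and c is reached
    -- by walks of length 4 from both b and d, hence meets both.
    let (x , bx , q , qx , qc) , _ = near
        i , i≢b , i≢d = third 3≤r (class b) (class d)
        y , qy , y-i = blockThrough q i
        by = meet-trans (λ b~y → i≢b (trans (sym y-i) (sym b~y))) bx (q , qx , qy)
        yd = meet-trans (λ y~d → i≢d (trans (sym y-i) y~d)) (q , qy , qc) cd
    in (y , by , yd) , λ _ → meet-trans b≁d by yd

  -- The walk is consumed two edges at a time, each pair leading through a point to a block that
  -- meets the previous one.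
  near-walk : ∀ {b c d k} → Near b c → Walk Γ k (inj₂ c) (inj₂ d) → Near b d
  near-walk near [] = near
  near-walk near (_∷_ {v = inj₂ _} a _) = contradiction a (Bipartite.right bip _ _)
  near-walk near (_∷_ {v = inj₁ _} _ (_∷_ {v = inj₁ _} a _)) = contradiction a (Bipartite.left bip _ _)
  near-walk near (_∷_ {v = inj₁ p} a (_∷_ {v = inj₂ _} a′ w)) =
    near-walk (near-meet near (p , symm a , a′)) w

  meets : ∀ {b c} → class b ≢ class c → Meet b c
  meets {b} {c} = proj₂ (near-walk (near-refl b) (proj₂ (conn (inj₂ b) (inj₂ c))))

  open AllMeet 3≤r meets

  -- First `h` moves `v` to `v′`, then the stabiliser of `v′` corrects the image of `u`.
  distance-transitive : ∀ {h v v′ u u′ d} → 1 ≤ d → d ≤ 4 → h ∈ Elem G → h · v ≡ v′ →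
    Distance Γ v u d → Distance Γ v′ u′ d → ∃[ g ] (g ∈ Elem G × g · v ≡ v′ × g · u ≡ u′)
  distance-transitive {h} {v′ = v′} {u} {d = d} 1≤d d≤4 h∈ hv δ δ′ =
    let g , g∈ , gv , gu = transitive v′ d 1≤d d≤4
          (subst (λ v → Distance Γ v (h · u) d) hv (distance-· h∈ δ)) δ′
    in g ↔-∘ h , closed-∘ g∈ h∈ , trans (cong (g ·_) hv) gv , gu

  point-transitive : ∀ {p p′ u u′ d} → 1 ≤ d → d ≤ 4 →
    Distance Γ (inj₁ p) u d → Distance Γ (inj₁ p′) u′ d →
    ∃[ g ] (g ∈ Elem G × g · inj₁ p ≡ inj₁ p′ × g · u ≡ u′)
  point-transitive {p} {p′} 1≤d d≤4 =
    let h , h∈ , hp = proj₂ transB p p′ in distance-transitive 1≤d d≤4 (subgroup h∈) hp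

  block-transitive : ∀ {b b′ u u′ d} → 1 ≤ d → d ≤ 4 →
    Distance Γ (inj₂ b) u d → Distance Γ (inj₂ b′) u′ d →
    ∃[ g ] (g ∈ Elem G × g · inj₂ b ≡ inj₂ b′ × g · u ≡ u′)
  block-transitive {b} {b′} 1≤d d≤4 =
    -- Since `N` is not transitive on blocks, an element taking `b` to `b′` comes from transitivity
    -- on incident pairs; `near-refl` supplies a point on each block.
    let (_ , (_ , pb , _) , _) , _ = near-refl b
        (_ , (_ , qb′ , _) , _) , _ = near-refl b′
        h , h∈ , _ , hb = point-transitive (s≤s z≤n) (s≤s z≤n) (distance-1 pb) (distance-1 qb′)
    in distance-transitive 1≤d d≤4 h∈ hb

  pairwiseTransitive : PairwiseTransitive D G
  pairwiseTransitive = record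
    { acts = actsOnDesign stab₁ stab₂
    ; incident = λ pb qc → point-transitive (s≤s z≤n) (s≤s z≤n) (distance-1 pb) (distance-1 qc)
    ; nonIncident = λ ¬pb ¬qc → point-transitive (s≤s z≤n) (s≤s (s≤s (s≤s z≤n)))
        (distance-3 ¬pb (point-block-walk _ _)) (distance-3 ¬qc (point-block-walk _ _))
    ; collinear = λ pq pq′ → point-transitive (s≤s z≤n) (s≤s (s≤s z≤n))
        (δ₂-points pq) (δ₂-points pq′)
    ; nonCollinear = λ pq pq′ → point-transitive (s≤s z≤n) (s≤s (s≤s (s≤s (s≤s z≤n))))
        (δ₄-points pq) (δ₄-points pq′)
    ; intersecting = λ bc bc′ → block-transitive (s≤s z≤n) (s≤s (s≤s z≤n))
        (δ₂-blocks bc) (δ₂-blocks bc′)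
    ; nonIntersecting = λ bc bc′ → block-transitive (s≤s z≤n) (s≤s (s≤s (s≤s (s≤s z≤n))))
        (δ₄-blocks bc) (δ₄-blocks bc′)
    }
    where
    δ₂-points : ∀ {p q} → Collinear D p q → Distance Γ (inj₁ p) (inj₁ q) 2
    δ₂-points (p≢q , pq) = distance-2 (p≢q ∘ inj₁-injective) (join⇒walk pq)

    δ₄-points : ∀ {p q} → NonCollinear D p q → Distance Γ (inj₁ p) (inj₁ q) 4
    δ₄-points (p≢q , ¬pq) =
      distance-4 (p≢q ∘ inj₁-injective) (¬pq ∘ walk⇒join) (point-walk _ _)

    δ₂-blocks : ∀ {b c} → Intersecting D b c → Distance Γ (inj₂ b) (inj₂ c) 2
    δ₂-blocks (b≢c , bc) = distance-2 (b≢c ∘ inj₂-injective) (meet⇒walk bc)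

    δ₄-blocks : ∀ {b c} → NonIntersecting D b c → Distance Γ (inj₂ b) (inj₂ c) 4
    δ₄-blocks (b≢c , ¬bc) =
      distance-4 (b≢c ∘ inj₂-injective) (¬bc ∘ walk⇒meet) (block-walk _ _)

  nicelyAffine : NicelyAffine D N
  nicelyAffine = record
    { acts = λ h∈ → actsOnDesign stab₁ stab₂ (subgroup h∈)
    ; transitive = transB
    -- The count for one reference pair from different classes. Any other such pair also intersects,
    -- so `G` carries it to the reference pair.
    ; μ = commonPoints D b₀ c₀
    ; meet = λ b≢c b≁c →
        let g , g∈ , gb , gc = PairwiseTransitive.intersecting pairwiseTransitive
              (b≢c , meets (b≁c ∘ sameOrbit)) (b₀≁c₀ ∘ cong class , meets b₀≁c₀)
        in commonPoints-· stab₁ g∈ gb gc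
    ; disjoint = λ b≢c b~c → disjoint (sameClass b~c) b≢c
    }
    where
    b₀ c₀ : Fin n
    b₀ = firstBlock 3≤r
    c₀ = proj₁ (representative (proj₁ (otherClass 3≤r b₀)))

    b₀≁c₀ : class b₀ ≢ class c₀
    b₀≁c₀ eq = proj₂ (otherClass 3≤r b₀)
      (trans (sym (proj₂ (representative (proj₁ (otherClass 3≤r b₀))))) (sym eq))

-- From the design back to local distance transitivity.

module Backward {m n} (Γ : Graph (Vertex m n)) (G N : PermGroup (Vertex m n)) {r : ℕ}
                (conn : Connected Γ) (bip : Bipartite Γ) (acts : ActsOnGraph Γ G)
                (N⊴G : N ⊴ G) (3≤r : 3 ≤ r) (¬complete : ¬ CompleteBipartite Γ)
                (pairwise : PairwiseTransitive (adjacencyDesign Γ) G)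
                (affine : NicelyAffine (adjacencyDesign Γ) N)
                (orbits : HasOrbits N inj₂ r) where

  open _⊴_ N⊴G
  open Walks Γ bip
  private
    module P = PairwiseTransitive pairwise
    module A = NicelyAffine affine
  open Classes Γ conn bip N (λ h∈ → acts (subgroup h∈)) A.transitive orbits

  -- Incidence is decidable on finite sets, so the negated universal statement yields witnesses,
  -- first the point and then the block.
  nonIncidentPair : ∃[ p ] ∃[ b ] ¬ (p I b)
  nonIncidentPair =
    let p , ¬pI = ¬∀⟶∃¬ m _ (λ p → all? (p I?_)) ¬complete
    in p , ¬∀⟶∃¬ n _ (p I?_) ¬pI

  meets : ∀ {b c} → class b ≢ class c → Meet b c
  meets {b} {c} b≁c =
    let p , b₁ , _ = nonIncidentPair
        i , i≢ = otherClass 3≤r b₁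
        b₀ , pb₀ , b₀~b₁ = blockThrough p (class b₁)
        c₀ , pc₀ , c₀-i = blockThrough p i
        b₀≁c₀ = λ eq → i≢ (trans (sym c₀-i) (trans (sym eq) b₀~b₁))
        -- The point `p` is itself common to `b₀` and `c₀`. Both counts equal `μ`, so the list of
        -- points common to `b` and `c` is nonempty too.
        μ>0 = ∈-length (∈-filter⁺ (λ q → (q I? b₀) ×-dec (q I? c₀)) (∈-allFin p) (pb₀ , pc₀))
        same = trans (A.meet (b₀≁c₀ ∘ cong class) (b₀≁c₀ ∘ sameClass))
                     (sym (A.meet (b≁c ∘ cong class) (b≁c ∘ sameClass)))
        q , q∈ = length⁺⇒∃∈ _ (subst (0 <_) same μ>0)
    in q , proj₂ (∈-filter⁻ (λ q → (q I? b) ×-dec (q I? c)) {xs = allFin m} q∈)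

  open AllMeet 3≤r meets

  -- Given `p` not on `b`, the block `c` through `p` in the class of `b` differs from `b` and hence
  -- is disjoint from it, so the two are at distance exactly 4.
  diameter : DiameterAtLeast Γ 4
  diameter =
    let p , b , ¬pb = nonIncidentPair
        c , pc , c~b = blockThrough p (class b)
        b≢c = λ b≡c → ¬pb (subst (p I_) (sym b≡c) pc)
    in inj₂ b , inj₂ c , 4 ,
       distance-4 (b≢c ∘ inj₂-injective)
         (A.disjoint b≢c (sameOrbit (sym c~b)) ∘ walk⇒meet) (block-walk b c) ,
       s≤s (s≤s (s≤s (s≤s z≤n)))

  -- Each distance from 1 to 4 corresponds to one of the design relations. Applied to two pairs
  -- sharing the member `v`, transitivity on that relation gives an element fixing `v`.
  stabiliser-transitive : ∀ v i → 1 ≤ i → i ≤ 4 → ∀ {u w} → Distance Γ v u i → Distance Γ v w i →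
    ∃[ g ] (g ∈ Elem G × g · v ≡ v × g · u ≡ w)
  stabiliser-transitive (inj₁ _) 1 _ _ δ δ′
    with _ , refl , pb ← point-distance-1 δ | _ , refl , pc ← point-distance-1 δ′ =
    P.incident pb pc
  stabiliser-transitive (inj₁ _) 2 _ _ δ δ′
    with _ , refl , pq ← point-distance-2 δ | _ , refl , ps ← point-distance-2 δ′ =
    P.collinear pq ps
  stabiliser-transitive (inj₁ _) 3 _ _ δ δ′
    with _ , refl , ¬pb ← point-distance-3 δ | _ , refl , ¬pc ← point-distance-3 δ′ =
    P.nonIncident ¬pb ¬pc
  stabiliser-transitive (inj₁ _) 4 _ _ δ δ′
    with _ , refl , pq ← point-distance-4 δ | _ , refl , ps ← point-distance-4 δ′ =
    P.nonCollinear pq ps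
  stabiliser-transitive (inj₂ _) 1 _ _ δ δ′
    with _ , refl , pb ← block-distance-1 δ | _ , refl , qb ← block-distance-1 δ′ =
    let g , g∈ , gp , gb = P.incident pb qb in g , g∈ , gb , gp
  stabiliser-transitive (inj₂ _) 2 _ _ δ δ′
    with _ , refl , bc ← block-distance-2 δ | _ , refl , bd ← block-distance-2 δ′ =
    P.intersecting bc bd
  stabiliser-transitive (inj₂ _) 3 _ _ δ δ′
    with _ , refl , ¬pb ← block-distance-3 δ | _ , refl , ¬qb ← block-distance-3 δ′ =
    let g , g∈ , gp , gb = P.nonIncident ¬pb ¬qb in g , g∈ , gb , gp
  stabiliser-transitive (inj₂ _) 4 _ _ δ δ′
    with _ , refl , bc ← block-distance-4 δ | _ , refl , bd ← block-distance-4 δ′ =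
    P.nonIntersecting bc bd
  stabiliser-transitive _ (suc (suc (suc (suc (suc _))))) _ (s≤s (s≤s (s≤s (s≤s ()))))

theorem1p4 : ∀ {m n : ℕ} (Γ : Graph (Vertex m n)) (G N : PermGroup (Vertex m n)) (r : ℕ) →
    Connected Γ → Bipartite Γ → ActsOnGraph Γ G → N ⊴ G → Nontrivial N → 3 ≤ r →
    ((Starlike Γ N r × LocallyDistanceTransitive Γ G 4) →
    (PairwiseTransitive (adjacencyDesign Γ) G × NicelyAffineWithClasses (adjacencyDesign Γ) N r))
    ×
    (¬ CompleteBipartite Γ →
    (PairwiseTransitive (adjacencyDesign Γ) G × NicelyAffineWithClasses (adjacencyDesign Γ) N r) →
    (Starlike Γ N r × LocallyDistanceTransitive Γ G 4))
theorem1p4 Γ G N r conn bip acts N⊴G _ 3≤r = a⇒b , b⇒a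
  where
  a⇒b : Starlike Γ N r × LocallyDistanceTransitive Γ G 4 →
        PairwiseTransitive (adjacencyDesign Γ) G × NicelyAffineWithClasses (adjacencyDesign Γ) N r
  a⇒b (star , ldt) = F.pairwiseTransitive , F.nicelyAffine , orbits-B′
    where
    open Starlike star using (transitive-B; orbits-B′)
    module F = Forward Γ G N conn bip acts N⊴G 3≤r transitive-B orbits-B′ ldt

  b⇒a : ¬ CompleteBipartite Γ →
        PairwiseTransitive (adjacencyDesign Γ) G × NicelyAffineWithClasses (adjacencyDesign Γ) N r →
        Starlike Γ N r × LocallyDistanceTransitive Γ G 4
  b⇒a ¬complete (pairwise , affine , orbits) =
    record
      { connected = conn
      ; bipartite = bip
      ; acts = λ h∈ → acts (_⊴_.subgroup N⊴G h∈)
      ; 2≤r = ≤-trans (n≤1+n 2) 3≤r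
      ; transitive-B = NicelyAffine.transitive affine
      ; orbits-B′ = orbits
      } ,
    record
      { diameter = B.diameter
      ; acts = acts
      ; transitive = B.stabiliser-transitive
      }
    where
    module B = Backward Γ G N conn bip acts N⊴G 3≤r ¬complete pairwise affine orbits
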